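{- Let $f:\mathbb{Z}^{+}\to\mathbb{C}$ be any function and let $g_f(m)=\sum_{d\mid m} f(d)$ for $m\ge 1$. For each integer $m\ge 0$ set $$B_{g_f,m} := g_f(m+1) - \sum_{b=\pm 1}\ \sum_{k=1}^{\left\lfloor \frac{\sqrt{24m+1}-b}{6}\right\rfloor} (-1)^{k+1}\, g_f\!\left(m+1-\frac{k(3k+b)}{2}\right).$$ Then for all $n\ge 1$, $$\begin{bmatrix} f(1)\\ f(2)\\ \vdots\\ f(n)\end{bmatrix} = A_n^{ -1}\begin{bmatrix} B_{g_f,0}\\ B_{g_f,1}\\ \vdots\\ B_{g_f,n-1}\end{bmatrix},$$ where $A_n=(a_{i,j})_{1\le i,j\le n}$ is the $n\times n$ matrix whose entries are the numbers $a_{i,j}$ defined in the context.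
   Context: The pair $(f,g_f)$ is related by the Lambert series $\sum_{n\ge1} \frac{f(n)q^n}{1-q^n}=\sum_{m\ge1} g_f(m)q^m$ (equivalently $g_f(m)=\sum_{d\mid m}f(d)$). Iverson bracket: $[P]_\delta=1$ if the condition $P$ is true and $0$ otherwise. For integers $n,i\ge 1$ define $$a_{n,i} = \sum_{b=\pm1}\ \sum_{s=0}^{\lfloor n/i\rfloor-1} (-1)^{\left\lfloor \frac{\sqrt{24(n-(s+1)i)+1}-b}{6}\right\rfloor}\left[\frac{\sqrt{24(n-(s+1)i)+1}-b}{6}\in\mathbb{Z}\right]_\delta ,$$ i.e. $a_{n,i}$ is the sum of $(-1)^k$ over all ways of writing $n=(s+1)i+\frac{k(3k\pm1)}{2}$ with integers $k,s\ge0$ (for each $s$, the value $k=0$ is counted only once, not once for each sign). Empty sums are $0$, so $a_{n,i}=0$ for $i>n$. The matrix $A_n=(a_{i,j})_{1\le i,j\le n}$ (row index $i$, column index $j$) is lower triangular with ones on its diagonal, hence invertible, and $A_n^{ -1}$ denotes its inverse. -}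

module Defs where

open import Algebra.Bundles using (CommutativeRing)
import Algebra.Definitions
import Algebra.Properties.Semiring.Exp
import Algebra.Properties.Semiring.Sum
open import Data.Bool.Base using (if_then_else_)
open import Data.Fin.Base using (Fin; toℕ)
import Data.Fin.Properties as Fin
open import Data.Integer.Base as ℤ using (ℤ; +_; -[1+_]; 1ℤ; -1ℤ; 0ℤ)
import Data.Integer.DivMod as ℤ
import Data.Integer.Properties as ℤ
open import Data.Integer.Tactic.RingSolver using (solve-∀)
open import Data.Nat.Base as ℕ using (ℕ; zero; suc; NonZero)
import Data.Nat.DivMod as ℕ
open import Data.Nat.Divisibility using (_∣?_)
import Data.Nat.Properties as ℕ
open import Data.Product.Base using (∃-syntax; _×_; _,_)
open import Data.Sum.Base using (_⊎_; inj₁; inj₂)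
open import Relation.Binary.PropositionalEquality
  using (_≡_; refl; sym; trans; cong; subst)
open import Relation.Nullary using (Dec; yes; no; does)
open import Relation.Nullary.Decidable using (map′; _×-dec_)

-- Comparison of the integer y with the real number √x.
infix 4 _≤√_ _≡√_

_≤√_ : ℤ → ℕ → Set
y ≤√ x = y ℤ.≤ 0ℤ ⊎ y ℤ.* y ℤ.≤ + x

_≡√_ : ℤ → ℕ → Set
y ≡√ x = 0ℤ ℤ.≤ y × y ℤ.* y ≡ + x

private
  step : ℕ → ℕ → ℕ
  step x r with suc r ℕ.* suc r ℕ.≤? x
  ... | yes _ = suc r
  ... | no  _ = r

⌊√_⌋ : ℕ → ℕ
⌊√ zero ⌋  = zero
⌊√ suc x ⌋ = step (suc x) ⌊√ x ⌋

⌊√⌋-lower : ∀ x → ⌊√ x ⌋ ℕ.* ⌊√ x ⌋ ℕ.≤ x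
⌊√⌋-lower zero = ℕ.z≤n
⌊√⌋-lower (suc x) = go ⌊√ x ⌋ (⌊√⌋-lower x)
  where
  go : ∀ r → r ℕ.* r ℕ.≤ x → step (suc x) r ℕ.* step (suc x) r ℕ.≤ suc x
  go r r²≤x with suc r ℕ.* suc r ℕ.≤? suc x
  ... | yes p = p
  ... | no  _ = ℕ.m≤n⇒m≤1+n r²≤x

⌊√⌋-upper : ∀ x → x ℕ.< suc ⌊√ x ⌋ ℕ.* suc ⌊√ x ⌋
⌊√⌋-upper zero = ℕ.s≤s ℕ.z≤n
⌊√⌋-upper (suc x) = go ⌊√ x ⌋ (⌊√⌋-upper x)
  where
  go : ∀ r → x ℕ.< suc r ℕ.* suc r →
       suc x ℕ.< suc (step (suc x) r) ℕ.* suc (step (suc x) r)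
  go r x<s² with suc r ℕ.* suc r ℕ.≤? suc x
  ... | yes _ = ℕ.≤-<-trans x<s²
                  (ℕ.*-mono-< (ℕ.n<1+n (suc r)) (ℕ.n<1+n (suc r)))
  ... | no ¬p = ℕ.≰⇒> ¬p

⌊√⌋-greatest : ∀ x y → y ℕ.* y ℕ.≤ x → y ℕ.≤ ⌊√ x ⌋
⌊√⌋-greatest x y y²≤x = ℕ.≮⇒≥ λ r<y →
  ℕ.<-irrefl refl (ℕ.<-≤-trans (⌊√⌋-upper x)
    (ℕ.≤-trans (ℕ.*-mono-≤ r<y r<y) y²≤x))

≤√⇒≤⌊√⌋ : ∀ {x} y → y ≤√ x → y ℤ.≤ + ⌊√ x ⌋
≤√⇒≤⌊√⌋ y        (inj₁ y≤0)  = ℤ.≤-trans y≤0 (ℤ.+≤+ ℕ.z≤n)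
≤√⇒≤⌊√⌋ -[1+ _ ] (inj₂ _)    = ℤ.-≤+
≤√⇒≤⌊√⌋ {x} (+ y) (inj₂ y²≤x) = ℤ.+≤+ (⌊√⌋-greatest x y
  (ℤ.drop‿+≤+ (subst (ℤ._≤ + x) (sym (ℤ.pos-* y y)) y²≤x)))

≤⌊√⌋⇒≤√ : ∀ {x} y → y ℤ.≤ + ⌊√ x ⌋ → y ≤√ x
≤⌊√⌋⇒≤√ -[1+ _ ] _ = inj₁ ℤ.-≤+
≤⌊√⌋⇒≤√ {x} (+ y) (ℤ.+≤+ y≤r) = inj₂ (subst (ℤ._≤ + x) (ℤ.pos-* y y)
  (ℤ.+≤+ (ℕ.≤-trans (ℕ.*-mono-≤ y≤r y≤r) (⌊√⌋-lower x))))

≡√⇒≡⌊√⌋ : ∀ {x} y → y ≡√ x → y ≡ + ⌊√ x ⌋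
≡√⇒≡⌊√⌋ {x} (+ y) (_ , y²≡x) = cong +_ (ℕ.≤-antisym
  (⌊√⌋-greatest x y (ℕ.≤-reflexive y²≡x′))
  (ℕ.≮⇒≥ λ y<r → ℕ.<-irrefl y²≡x′
    (ℕ.<-≤-trans (ℕ.*-mono-< y<r y<r) (⌊√⌋-lower x))))
  where
  y²≡x′ : y ℕ.* y ≡ x
  y²≡x′ = ℤ.+-injective (trans (ℤ.pos-* y y) y²≡x)

-- ℤ._/ℕ_ rounds towards −∞, and ⌊(√x − b)/6⌋ = ⌊(⌊√x⌋ − b)/6⌋ because b
-- is an integer; ≤⌊⌋⇒ and ⇒≤⌊⌋ below are the defining property of the
-- floor.
⌊[√_-_]/6⌋ : ℕ → ℤ → ℤ
⌊[√ x - b ]/6⌋ = (+ ⌊√ x ⌋ ℤ.- b) ℤ./ℕ 6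

-- k = (√x − b)/6 for some integer k.
[√_-_]/6∈ℤ : ℕ → ℤ → Set
[√ x - b ]/6∈ℤ = ∃[ k ] (+ 6 ℤ.* k ℤ.+ b) ≡√ x

private
  move⇒ : ∀ k b r → + 6 ℤ.* k ℤ.+ b ℤ.≤ r → k ℤ.* + 6 ℤ.≤ r ℤ.- b
  move⇒ k b r p = subst (ℤ._≤ r ℤ.- b) (eq k b) (ℤ.+-monoˡ-≤ (ℤ.- b) p)
    where
    eq : ∀ k b → (+ 6 ℤ.* k ℤ.+ b) ℤ.- b ≡ k ℤ.* + 6
    eq = solve-∀

  move⇐ : ∀ k b r → k ℤ.* + 6 ℤ.≤ r ℤ.- b → + 6 ℤ.* k ℤ.+ b ℤ.≤ r
  move⇐ k b r p = begin
    + 6 ℤ.* k ℤ.+ b    ≡⟨ cong (ℤ._+ b) (ℤ.*-comm (+ 6) k) ⟩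
    k ℤ.* + 6 ℤ.+ b    ≤⟨ ℤ.+-monoˡ-≤ b p ⟩
    r ℤ.- b ℤ.+ b      ≡⟨ eq r b ⟩
    r                  ∎
    where
    open ℤ.≤-Reasoning
    eq : ∀ r b → r ℤ.- b ℤ.+ b ≡ r
    eq = solve-∀

  ≤/6 : ∀ k n → k ℤ.* + 6 ℤ.≤ n → k ℤ.≤ n ℤ./ℕ 6
  ≤/6 k n p = subst (k ℤ.≤_) (ℤ.pred-suc (n ℤ./ℕ 6))
    (ℤ.i<j⇒i≤pred[j] (ℤ.*-cancelʳ-<-nonNeg {k} {ℤ.suc (n ℤ./ℕ 6)} (+ 6)
      (ℤ.≤-<-trans p (ℤ.n<s[n/ℕd]*d n 6))))

  /6≤ : ∀ k n → k ℤ.≤ n ℤ./ℕ 6 → k ℤ.* + 6 ℤ.≤ n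
  /6≤ k n p = ℤ.≤-trans (ℤ.*-monoʳ-≤-nonNeg (+ 6) p) (ℤ.[n/ℕd]*d≤n n 6)

≤⌊⌋⇒ : ∀ x b k → k ℤ.≤ ⌊[√ x - b ]/6⌋ → + 6 ℤ.* k ℤ.+ b ≤√ x
≤⌊⌋⇒ x b k p = ≤⌊√⌋⇒≤√ _ (move⇐ k b _ (/6≤ k _ p))

⇒≤⌊⌋ : ∀ x b k → + 6 ℤ.* k ℤ.+ b ≤√ x → k ℤ.≤ ⌊[√ x - b ]/6⌋
⇒≤⌊⌋ x b k p = ≤/6 k _ (move⇒ k b _ (≤√⇒≤⌊√⌋ _ p))

∈ℤ⇒≡⌊⌋ : ∀ x b k → (+ 6 ℤ.* k ℤ.+ b) ≡√ x → k ≡ ⌊[√ x - b ]/6⌋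
∈ℤ⇒≡⌊⌋ x b k p = ℤ.≤-antisym
  (⇒≤⌊⌋ x b k (≤⌊√⌋⇒≤√ _ (ℤ.≤-reflexive y≡r)))
  (ℤ.*-cancelʳ-≤-pos _ k (+ 6) (ℤ.≤-trans (ℤ.[n/ℕd]*d≤n _ 6)
    (ℤ.≤-reflexive (trans (cong (ℤ._- b) (sym y≡r)) (eq k b)))))
  where
  y≡r : + 6 ℤ.* k ℤ.+ b ≡ + ⌊√ x ⌋
  y≡r = ≡√⇒≡⌊√⌋ _ p
  eq : ∀ k b → (+ 6 ℤ.* k ℤ.+ b) ℤ.- b ≡ k ℤ.* + 6
  eq = solve-∀

[√_-_]/6∈ℤ? : ∀ x b → Dec [√ x - b ]/6∈ℤ
[√ x - b ]/6∈ℤ? = map′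
  (λ p → ⌊[√ x - b ]/6⌋ , p)
  (λ (k , p) → subst (λ j → (+ 6 ℤ.* j ℤ.+ b) ≡√ x) (∈ℤ⇒≡⌊⌋ x b k p) p)
  ((0ℤ ℤ.≤? y) ×-dec (y ℤ.* y ℤ.≟ + x))
  where
  y : ℤ
  y = + 6 ℤ.* ⌊[√ x - b ]/6⌋ ℤ.+ b

-- k(3k + b)/2; the numerator is even, and nonnegative for b = ±1.
pentagonal : ℕ → ℤ → ℕ
pentagonal k b = ℤ.∣ + k ℤ.* (+ 3 ℤ.* + k ℤ.+ b) ∣ ℕ./ 2

-- Only the ring operations of ℂ are involved, so everything is set over an
-- arbitrary commutative ring.
module LambertFactorization {c ℓ} (R : CommutativeRing c ℓ) where

  open CommutativeRing R public
    using (Carrier; _≈_; _+_; _*_; _-_; -_; 0#; 1#)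
  open Algebra.Properties.Semiring.Exp (CommutativeRing.semiring R) public
    using (_^_)
  open Algebra.Properties.Semiring.Sum (CommutativeRing.semiring R) public
    using (sum-syntax)

  [_]δ : ∀ {p} {P : Set p} → Dec P → Carrier
  [ P? ]δ = if does P? then 1# else 0#

  ∑[b=±1] : (ℤ → Carrier) → Carrier
  ∑[b=±1] t = t 1ℤ + t -1ℤ

  -- Functions on ℤ⁺.
  Arithmetic : Set c
  Arithmetic = (n : ℕ) .{{_ : NonZero n}} → Carrier

  -- g_f(m) = ∑_{d ∣ m} f(d) for m ≥ 1, with d ranging over 1, …, m.  The
  -- value at m = 0 is the empty sum and is never used.
  g : Arithmetic → ℕ → Carrier
  g f m = ∑[ i < m ] ([ suc (toℕ i) ∣? m ]δ * f (suc (toℕ i)))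

  -- In both definitions below x ∸ y is only used with y ≤ x and ∣_∣ only
  -- on nonnegative integers: 24m + 1 ≥ 1 makes the floor nonnegative, and
  -- k ≤ ⌊(√(24m+1) − b)/6⌋ forces k(3k+b)/2 ≤ m.
  a : (n i : ℕ) .{{_ : NonZero i}} → Carrier
  a n i = ∑[b=±1] λ b → ∑[ s < n ℕ./ i ]
    let x = 24 ℕ.* (n ℕ.∸ suc (toℕ s) ℕ.* i) ℕ.+ 1 in
    (- 1#) ^ ℤ.∣ ⌊[√ x - b ]/6⌋ ∣ * [ [√ x - b ]/6∈ℤ? ]δ

  B : (ℕ → Carrier) → ℕ → Carrier
  B h m = h (m ℕ.+ 1) - (∑[b=±1] λ b →
    ∑[ j < ℤ.∣ ⌊[√ 24 ℕ.* m ℕ.+ 1 - b ]/6⌋ ∣ ]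
      let k = suc (toℕ j) in
      ((- 1#) ^ (k ℕ.+ 1) * h (m ℕ.+ 1 ℕ.∸ pentagonal k b)))

  Vector : ℕ → Set c
  Vector n = Fin n → Carrier

  Matrix : ℕ → Set c
  Matrix n = Fin n → Fin n → Carrier

  infix  4 _≈ᴹ_ _≈ⱽ_
  infixl 7 _*ᴹ_ _*ⱽ_

  _≈ⱽ_ : ∀ {n} → Vector n → Vector n → Set ℓ
  u ≈ⱽ v = ∀ i → u i ≈ v i

  _≈ᴹ_ : ∀ {n} → Matrix n → Matrix n → Set ℓ
  M ≈ᴹ N = ∀ i j → M i j ≈ N i j

  _*ᴹ_ : ∀ {n} → Matrix n → Matrix n → Matrix n
  _*ᴹ_ {n} M N i j = ∑[ k < n ] (M i k * N k j)

  _*ⱽ_ : ∀ {n} → Matrix n → Vector n → Vector n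
  _*ⱽ_ {n} M v i = ∑[ k < n ] (M i k * v k)

  1ᴹ : ∀ {n} → Matrix n
  1ᴹ i j = [ i Fin.≟ j ]δ

  -- Two-sided inverses, so unique up to _≈ᴹ_.
  Invertible : ∀ {n} → Matrix n → Set _
  Invertible {n} = Algebra.Definitions.Invertible (_≈ᴹ_ {n}) 1ᴹ _*ᴹ_

  A : ∀ n → Matrix n
  A n i j = a (suc (toℕ i)) (suc (toℕ j))

{-# OPTIONS --safe #-}
module Submission where

-- Why the theorem holds.  Write P(k, b) = k(3k + b)/2 and, for b = ±1, let
-- e b N be (-1)^k if N = P(k, b) for an integer k with 6k + b ≥ 0, and 0
-- otherwise; so e b N is the b-summand in the definition of a.  Then
--
--   a n i = ∑_b ∑_{s ≥ 1, si ≤ n} e b (n - si).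
--
-- Multiplying by f(i), summing over i and grouping the pairs (s, i) by the
-- product t = si replaces f by its divisor sum (sum-divisors):
--
--   ∑_i a n i f(i) = ∑_b ∑_{1 ≤ t ≤ n} e b (n - t) g(t).
--
-- With n = m + 1 and N = n - t, the inner sum runs over 0 ≤ N ≤ m, and only
-- the pentagonal numbers N contribute (pentagonalSign-convolution).  The
-- term N = 0 appears for b = 1 only and gives g(m + 1), while N = P(k, b)
-- with k ≥ 1 gives (-1)^k g(m + 1 - P(k, b)); together they are B_{g,m}.
-- Thus A f = B (A*f≈B).  Euler's pentagonal number theorem plays no role.
--
-- It remains to multiply by the inverse of A, which exists because A is
-- lower triangular with unit diagonal (A-unitLower, unitLower⇒invertible).
--
-- Both regroupings of sums, and the truncations of ranges of summation, are
-- instances of one fact: a sum may be reindexed along an injection outside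
-- of whose image the summand vanishes (sum-reindex, sum-sparse).

open import Defs
open import Algebra.Bundles using (CommutativeRing)
import Algebra.Properties.Ring
import Algebra.Properties.Semiring.Sum
open import Data.Empty using (⊥-elim)
open import Data.Fin.Base as Fin using (Fin; zero; suc; toℕ; fromℕ<; inject≤; opposite)
import Data.Fin.Properties as Fin
open import Data.Integer.Base as ℤ using (ℤ; +_; 0ℤ; 1ℤ; -1ℤ)
import Data.Integer.Properties as ℤ
open import Data.Integer.Tactic.RingSolver using (solve-∀)
open import Data.Nat.Base as ℕ using (ℕ; zero; suc; NonZero)
open import Data.Nat.Divisibility using (_∣?_; divides; ∣⇒≤; n∣m*n)
import Data.Nat.DivMod as ℕ
import Data.Nat.Properties as ℕ
open import Data.Product.Base using (Σ; ∃-syntax; _×_; _,_; proj₁; proj₂)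
open import Data.Sum.Base using (_⊎_; inj₁; inj₂)
open import Function.Base using (_∘_)
open import Relation.Binary.PropositionalEquality as ≡ using (_≡_; _≢_; cong)
import Relation.Binary.Reasoning.Setoid
open import Relation.Nullary using (Dec; yes; no; ¬_)

-- Pentagonal numbers and the integers (√(24N + 1) - b)/6

-- The two values of the sign b.
±1 : ℤ → Set
±1 b = b ≡ 1ℤ ⊎ b ≡ -1ℤ

b²≡1 : ∀ {b} → ±1 b → b ℤ.* b ≡ 1ℤ
b²≡1 (inj₁ ≡.refl) = ≡.refl
b²≡1 (inj₂ ≡.refl) = ≡.refl

-- The radicand, named for the discriminant of k(3k + b) = 2N: a root k has
-- 6k + b = √(24N + 1) up to sign.
disc : ℕ → ℕ
disc N = 24 ℕ.* N ℕ.+ 1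

-- ⌊(√(24N + 1) - b)/6⌋ as a natural number; the floor is nonnegative for
-- b = ±1 (0≤floor).  It is the largest k with P(k, b) ≤ N, and equals k when
-- N = P(k, b) with k ≥ 1 (root-pentagonal).
root : ℕ → ℤ → ℕ
root N b = ℤ.∣ ⌊[√ disc N - b ]/6⌋ ∣

-- By induction on k: the numerator grows by 2(3k + 2) for b = 1 and by
-- 2(3k + 1) for b = -1.
numerator-even : ∀ {b} → ±1 b → ∀ k →
  ∃[ t ] + k ℤ.* (+ 3 ℤ.* + k ℤ.+ b) ≡ + t ℤ.* + 2
numerator-even _ zero = 0 , ≡.refl
numerator-even b∈ (suc k) with numerator-even b∈ k
numerator-even (inj₁ ≡.refl) (suc k) | t , eq = t ℕ.+ (3 ℕ.* k ℕ.+ 2) , (begin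
  (1ℤ ℤ.+ + k) ℤ.* (+ 3 ℤ.* (1ℤ ℤ.+ + k) ℤ.+ 1ℤ)                ≡⟨ expand (+ k) ⟩
  + k ℤ.* (+ 3 ℤ.* + k ℤ.+ 1ℤ) ℤ.+ (+ 3 ℤ.* + k ℤ.+ + 2) ℤ.* + 2 ≡⟨ ≡.cong₂ (λ u v → u ℤ.+ (v ℤ.+ + 2) ℤ.* + 2) eq (≡.sym (ℤ.pos-* 3 k)) ⟩
  + t ℤ.* + 2 ℤ.+ + (3 ℕ.* k ℕ.+ 2) ℤ.* + 2                     ≡⟨ ℤ.*-distribʳ-+ (+ 2) (+ t) (+ (3 ℕ.* k ℕ.+ 2)) ⟨
  + (t ℕ.+ (3 ℕ.* k ℕ.+ 2)) ℤ.* + 2                             ∎)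
  where
  open ≡.≡-Reasoning
  expand : ∀ k → (1ℤ ℤ.+ k) ℤ.* (+ 3 ℤ.* (1ℤ ℤ.+ k) ℤ.+ 1ℤ) ≡
                 k ℤ.* (+ 3 ℤ.* k ℤ.+ 1ℤ) ℤ.+ (+ 3 ℤ.* k ℤ.+ + 2) ℤ.* + 2
  expand = solve-∀
numerator-even (inj₂ ≡.refl) (suc k) | t , eq = t ℕ.+ (3 ℕ.* k ℕ.+ 1) , (begin
  (1ℤ ℤ.+ + k) ℤ.* (+ 3 ℤ.* (1ℤ ℤ.+ + k) ℤ.+ -1ℤ)                ≡⟨ expand (+ k) ⟩
  + k ℤ.* (+ 3 ℤ.* + k ℤ.+ -1ℤ) ℤ.+ (+ 3 ℤ.* + k ℤ.+ 1ℤ) ℤ.* + 2 ≡⟨ ≡.cong₂ (λ u v → u ℤ.+ (v ℤ.+ 1ℤ) ℤ.* + 2) eq (≡.sym (ℤ.pos-* 3 k)) ⟩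
  + t ℤ.* + 2 ℤ.+ + (3 ℕ.* k ℕ.+ 1) ℤ.* + 2                      ≡⟨ ℤ.*-distribʳ-+ (+ 2) (+ t) (+ (3 ℕ.* k ℕ.+ 1)) ⟨
  + (t ℕ.+ (3 ℕ.* k ℕ.+ 1)) ℤ.* + 2                              ∎)
  where
  open ≡.≡-Reasoning
  expand : ∀ k → (1ℤ ℤ.+ k) ℤ.* (+ 3 ℤ.* (1ℤ ℤ.+ k) ℤ.+ -1ℤ) ≡
                 k ℤ.* (+ 3 ℤ.* k ℤ.+ -1ℤ) ℤ.+ (+ 3 ℤ.* k ℤ.+ 1ℤ) ℤ.* + 2
  expand = solve-∀

-- The truncations in the definition of pentagonal lose nothing.
pentagonal*2 : ∀ {b} → ±1 b → ∀ k →
  + k ℤ.* (+ 3 ℤ.* + k ℤ.+ b) ≡ + pentagonal k b ℤ.* + 2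
pentagonal*2 {b} b∈ k with numerator-even b∈ k
... | t , eq = ≡.trans eq (cong (λ u → + u ℤ.* + 2) (≡.sym (begin
  ℤ.∣ + k ℤ.* (+ 3 ℤ.* + k ℤ.+ b) ∣ ℕ./ 2  ≡⟨ cong (λ u → ℤ.∣ u ∣ ℕ./ 2) eq ⟩
  ℤ.∣ + t ℤ.* + 2 ∣ ℕ./ 2                  ≡⟨ cong (ℕ._/ 2) (ℤ.abs-* (+ t) (+ 2)) ⟩
  t ℕ.* 2 ℕ./ 2                            ≡⟨ ℕ.m*n/n≡m t 2 ⟩
  t                                        ∎)))
  where open ≡.≡-Reasoning

-- 24 P(k, b) + 1 = 36k² + 12kb + b² = (6k + b)².
complete-square : ∀ {b} → ±1 b → ∀ k → let y = + 6 ℤ.* + k ℤ.+ b in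
  y ℤ.* y ≡ + disc (pentagonal k b)
complete-square {b} b∈ k = begin
  (+ 6 ℤ.* + k ℤ.+ b) ℤ.* (+ 6 ℤ.* + k ℤ.+ b)              ≡⟨ expand (+ k) b ⟩
  + 12 ℤ.* (+ k ℤ.* (+ 3 ℤ.* + k ℤ.+ b)) ℤ.+ b ℤ.* b       ≡⟨ ≡.cong₂ (λ u v → + 12 ℤ.* u ℤ.+ v) (pentagonal*2 b∈ k) (b²≡1 b∈) ⟩
  + 12 ℤ.* (+ pentagonal k b ℤ.* + 2) ℤ.+ 1ℤ               ≡⟨ cong (ℤ._+ 1ℤ) (collect (+ pentagonal k b)) ⟩
  + 24 ℤ.* + pentagonal k b ℤ.+ 1ℤ                         ≡⟨ cong (ℤ._+ 1ℤ) (ℤ.pos-* 24 (pentagonal k b)) ⟨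
  + disc (pentagonal k b)                                  ∎
  where
  open ≡.≡-Reasoning
  expand : ∀ k b → (+ 6 ℤ.* k ℤ.+ b) ℤ.* (+ 6 ℤ.* k ℤ.+ b) ≡
                   + 12 ℤ.* (k ℤ.* (+ 3 ℤ.* k ℤ.+ b)) ℤ.+ b ℤ.* b
  expand = solve-∀
  collect : ∀ p → + 12 ℤ.* (p ℤ.* + 2) ≡ + 24 ℤ.* p
  collect = solve-∀

disc-injective : ∀ {M N} → disc M ≡ disc N → M ≡ N
disc-injective {M} {N} eq = ℕ.*-cancelˡ-≡ M N 24 (ℕ.+-cancelʳ-≡ 1 (24 ℕ.* M) (24 ℕ.* N) eq)

disc-mono : ∀ {M N} → M ℕ.≤ N → disc M ℕ.≤ disc N
disc-mono M≤N = ℕ.+-monoˡ-≤ 1 (ℕ.*-monoʳ-≤ 24 M≤N)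

disc-cancel-≤ : ∀ {M N} → disc M ℕ.≤ disc N → M ℕ.≤ N
disc-cancel-≤ {M} {N} p = ℕ.*-cancelˡ-≤ 24 (ℕ.+-cancelʳ-≤ 1 (24 ℕ.* M) (24 ℕ.* N) p)

6k+b>0 : ∀ {b} → ±1 b → ∀ j → 0ℤ ℤ.< + 6 ℤ.* + suc j ℤ.+ b
6k+b>0 {b} b∈ j = ℤ.<-≤-trans (0<6+b b∈)
  (ℤ.+-monoˡ-≤ b (ℤ.*-monoˡ-≤-nonNeg (+ 6) (ℤ.+≤+ (ℕ.s≤s ℕ.z≤n))))
  where
  0<6+b : ∀ {b} → ±1 b → 0ℤ ℤ.< + 6 ℤ.* 1ℤ ℤ.+ b
  0<6+b (inj₁ ≡.refl) = ℤ.+<+ (ℕ.s≤s ℕ.z≤n)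
  0<6+b (inj₂ ≡.refl) = ℤ.+<+ (ℕ.s≤s ℕ.z≤n)

0≤floor : ∀ {b} → ±1 b → ∀ N → 0ℤ ℤ.≤ ⌊[√ disc N - b ]/6⌋
0≤floor {b} b∈ N = ⇒≤⌊⌋ (disc N) b 0ℤ (b≤√ b∈)
  where
  b≤√ : ∀ {b} → ±1 b → + 6 ℤ.* 0ℤ ℤ.+ b ≤√ disc N
  b≤√ (inj₁ ≡.refl) = inj₂ (ℤ.+≤+ (ℕ.m≤n+m 1 (24 ℕ.* N)))
  b≤√ (inj₂ ≡.refl) = inj₁ ℤ.-≤+

root≡floor : ∀ {b} → ±1 b → ∀ N → + root N b ≡ ⌊[√ disc N - b ]/6⌋
root≡floor b∈ N = ℤ.0≤i⇒+∣i∣≡i (0≤floor b∈ N)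

-- The case k = 0 is excluded, here and below, because 6k + b is negative for
-- k = 0 and b = -1; hence the argument suc j.
pentagonal-root : ∀ {b} → ±1 b → ∀ j → let N = pentagonal (suc j) b in
  (+ 6 ℤ.* + suc j ℤ.+ b) ≡√ disc N
pentagonal-root b∈ j = ℤ.<⇒≤ (6k+b>0 b∈ j) , complete-square b∈ (suc j)

pentagonal-∈ℤ : ∀ {b} → ±1 b → ∀ j → [√ disc (pentagonal (suc j) b) - b ]/6∈ℤ
pentagonal-∈ℤ b∈ j = + suc j , pentagonal-root b∈ j

root-pentagonal : ∀ {b} → ±1 b → ∀ j → root (pentagonal (suc j) b) b ≡ suc j
root-pentagonal {b} b∈ j =
  cong ℤ.∣_∣ (≡.sym (∈ℤ⇒≡⌊⌋ (disc (pentagonal (suc j) b)) b (+ suc j) (pentagonal-root b∈ j)))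

-- The converse of pentagonal-∈ℤ; here k = 0 is possible, for N = 0 and b = 1.
∈ℤ⇒pentagonal : ∀ {b} → ±1 b → ∀ N → [√ disc N - b ]/6∈ℤ → N ≡ pentagonal (root N b) b
∈ℤ⇒pentagonal {b} b∈ N (k , p) = disc-injective
  (ℤ.+-injective (≡.trans (≡.sym (proj₂ p′)) (complete-square b∈ (root N b))))
  where
  p′ : (+ 6 ℤ.* + root N b ℤ.+ b) ≡√ disc N
  p′ = ≡.subst (λ i → (+ 6 ℤ.* i ℤ.+ b) ≡√ disc N)
         (≡.trans (∈ℤ⇒≡⌊⌋ (disc N) b k p) (≡.sym (root≡floor b∈ N))) p

-- This and ≤root identify the range 1 ≤ k ≤ root m b with the set of k ≥ 1
-- such that P(k, b) ≤ m.
pentagonal≤ : ∀ {b} → ±1 b → ∀ {m} j → suc j ℕ.≤ root m b → pentagonal (suc j) b ℕ.≤ m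
pentagonal≤ {b} b∈ {m} j j<K with
  ≤⌊⌋⇒ (disc m) b (+ suc j) (≡.subst (+ suc j ℤ.≤_) (root≡floor b∈ m) (ℤ.+≤+ j<K))
... | inj₁ y≤0 = ⊥-elim (ℤ.<-irrefl ≡.refl (ℤ.<-≤-trans (6k+b>0 b∈ j) y≤0))
... | inj₂ y²≤ = disc-cancel-≤ (ℤ.drop‿+≤+ (≡.subst (ℤ._≤ + disc m) (complete-square b∈ (suc j)) y²≤))

≤root : ∀ {b} → ±1 b → ∀ {m} k → pentagonal k b ℕ.≤ m → k ℕ.≤ root m b
≤root {b} b∈ {m} k p = ℤ.drop‿+≤+ (≡.subst (+ k ℤ.≤_) (≡.sym (root≡floor b∈ m))
  (⇒≤⌊⌋ (disc m) b (+ k) (inj₂ (≡.subst (ℤ._≤ + disc m) (≡.sym (complete-square b∈ k)) (ℤ.+≤+ (disc-mono p))))))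

module _ {c ℓ} (R : CommutativeRing c ℓ) where
  open CommutativeRing R hiding (Carrier; _≈_; _+_; _*_; _-_; -_; 0#; 1#; zero)
  open LambertFactorization R
  open Algebra.Properties.Semiring.Sum semiring
    using (sum; sum-cong-≋; ∑-distrib-+; ∑-comm; sum-replicate-zero; *-distribˡ-sum; *-distribʳ-sum)
  open Algebra.Properties.Ring ring
    using (-1*x≈-x; -‿distribˡ-*; -‿+-comm; -0#≈0#; -‿involutive)
  open Relation.Binary.Reasoning.Setoid setoid

  -- Finite sums in a commutative ring

  δ-yes : ∀ {p} {P : Set p} (P? : Dec P) → P → [ P? ]δ ≈ 1#
  δ-yes (yes _) _ = refl
  δ-yes (no ¬p) p = ⊥-elim (¬p p)

  δ-no : ∀ {p} {P : Set p} (P? : Dec P) → ¬ P → [ P? ]δ ≈ 0#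
  δ-no (yes p) ¬p = ⊥-elim (¬p p)
  δ-no (no _)  _  = refl

  δ-no-* : ∀ {p} {P : Set p} (P? : Dec P) x → ¬ P → [ P? ]δ * x ≈ 0#
  δ-no-* P? x ¬p = trans (*-congʳ (δ-no P? ¬p)) (zeroˡ x)

  sum-zero : ∀ {n} (F : Fin n → Carrier) → (∀ t → F t ≈ 0#) → sum F ≈ 0#
  sum-zero {n} F F≈0 = trans (sum-cong-≋ F≈0) (sum-replicate-zero n)

  sum-single : ∀ {n} (F : Fin n → Carrier) t₀ → (∀ t → t ≢ t₀ → F t ≈ 0#) → sum F ≈ F t₀
  sum-single F zero     F≈0 =
    trans (+-congˡ (sum-zero (F ∘ suc) λ t → F≈0 (suc t) λ ())) (+-identityʳ _)
  sum-single F (suc t₀) F≈0 =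
    trans (+-cong (F≈0 zero λ ())
                  (sum-single (F ∘ suc) t₀ λ t t≢ → F≈0 (suc t) (t≢ ∘ Fin.suc-injective)))
          (+-identityˡ _)

  -- A sum is unchanged when it is restricted along an injection p outside of
  -- whose image the summand vanishes: insert [ p j = t ] and exchange sums.
  sum-reindex : ∀ {k n} (F : Fin n → Carrier) (p : Fin k → Fin n) →
    (∀ {i j} → p i ≡ p j → i ≡ j) →
    (∀ t → F t ≈ 0# ⊎ ∃[ j ] p j ≡ t) →
    sum F ≈ sum (F ∘ p)
  sum-reindex {k} {n} F p p-inj supp = begin
    ∑[ t < n ] F t                                  ≈⟨ sum-cong-≋ fibre ⟩
    ∑[ t < n ] ∑[ j < k ] ([ p j Fin.≟ t ]δ * F t)  ≈⟨ ∑-comm (λ t j → [ p j Fin.≟ t ]δ * F t) ⟩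
    ∑[ j < k ] ∑[ t < n ] ([ p j Fin.≟ t ]δ * F t)  ≈⟨ sum-cong-≋ (λ j →
      trans (sum-single _ (p j) λ t t≢ → δ-no-* (p j Fin.≟ t) (F t) (t≢ ∘ ≡.sym))
            (trans (*-congʳ (δ-yes (p j Fin.≟ p j) ≡.refl)) (*-identityˡ _))) ⟩
    ∑[ j < k ] F (p j)                              ∎
    where
    fibre : ∀ t → F t ≈ ∑[ j < k ] ([ p j Fin.≟ t ]δ * F t)
    fibre t with supp t
    ... | inj₁ Ft≈0 = trans Ft≈0 (sym (sum-zero (λ j → [ p j Fin.≟ t ]δ * F t) λ j →
      trans (*-congˡ Ft≈0) (zeroʳ _)))
    ... | inj₂ (j₀ , ≡.refl) = sym (trans
      (sum-single _ j₀ λ j j≢ → δ-no-* (p j Fin.≟ t) (F t) (j≢ ∘ p-inj))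
      (trans (*-congʳ (δ-yes (t Fin.≟ t) ≡.refl)) (*-identityˡ _)))

  sum-reverse : ∀ m (F : ℕ → Carrier) →
    ∑[ t < suc m ] F (toℕ t) ≈ ∑[ t < suc m ] F (m ℕ.∸ toℕ t)
  sum-reverse m F = trans
    (sum-reindex (F ∘ toℕ) opposite opposite-injective
      λ t → inj₂ (opposite t , Fin.opposite-involutive t))
    (sum-cong-≋ {suc m} {F ∘ toℕ ∘ opposite} {λ t → F (m ℕ.∸ toℕ t)}
      λ t → reflexive (cong F (Fin.opposite-prop t)))
    where
    opposite-injective : ∀ {i j : Fin (suc m)} → opposite i ≡ opposite j → i ≡ j
    opposite-injective {i} {j} eq = ≡.trans (≡.sym (Fin.opposite-involutive i))
      (≡.trans (cong opposite eq) (Fin.opposite-involutive j))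

  -- Reindexing for sums over 1, …, n whose summand is supported on the values
  -- P 0, …, P (k - 1) of an injective sequence of positive integers.
  sum-sparse : ∀ {n k} (F : ℕ → Carrier) (P : ℕ → ℕ) →
    (∀ j → 0 ℕ.< P j) →
    (∀ {i j} → P i ≡ P j → i ≡ j) →
    (∀ {j} → j ℕ.< k → P j ℕ.≤ n) →
    (∀ t → t ℕ.< n → F (suc t) ≈ 0# ⊎ ∃[ j ] j ℕ.< k × P j ≡ suc t) →
    ∑[ t < n ] F (suc (toℕ t)) ≈ ∑[ j < k ] F (P (toℕ j))
  sum-sparse {n} {k} F P P>0 P-inj P≤n supp = trans
    (sum-reindex (F ∘ suc ∘ toℕ) p p-inj supp′)
    (sum-cong-≋ {k} λ j → reflexive (cong F (toℕ-p j)))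
    where
    sucpred : ∀ j → suc (ℕ.pred (P j)) ≡ P j
    sucpred j = ℕ.suc-pred (P j) {{ℕ.>-nonZero (P>0 j)}}

    index< : ∀ {j} → j ℕ.< k → ℕ.pred (P j) ℕ.< n
    index< {j} j<k = ≡.subst (ℕ._≤ n) (≡.sym (sucpred j)) (P≤n j<k)

    p : Fin k → Fin n
    p j = fromℕ< (index< (Fin.toℕ<n j))

    toℕ-p : ∀ j → suc (toℕ (p j)) ≡ P (toℕ j)
    toℕ-p j = ≡.trans (cong suc (Fin.toℕ-fromℕ< (index< (Fin.toℕ<n j)))) (sucpred (toℕ j))

    p-inj : ∀ {i j} → p i ≡ p j → i ≡ j
    p-inj {i} {j} eq = Fin.toℕ-injective (P-inj
      (≡.trans (≡.sym (toℕ-p i)) (≡.trans (cong (suc ∘ toℕ) eq) (toℕ-p j))))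

    supp′ : ∀ t → F (suc (toℕ t)) ≈ 0# ⊎ ∃[ j ] p j ≡ t
    supp′ t with supp (toℕ t) (Fin.toℕ<n t)
    ... | inj₁ F≈0 = inj₁ F≈0
    ... | inj₂ (j , j<k , Pj≡) = inj₂ (fromℕ< j<k , Fin.toℕ-injective (ℕ.suc-injective
      (≡.trans (toℕ-p (fromℕ< j<k)) (≡.trans (cong P (Fin.toℕ-fromℕ< j<k)) Pj≡))))

  -- The left side runs over the multiples of suc i that are at most n.
  sum-multiples : ∀ n i (E : ℕ → Carrier) →
    ∑[ s < n ℕ./ suc i ] E (suc (toℕ s) ℕ.* suc i) ≈
    ∑[ t < n ] ([ suc i ∣? suc (toℕ t) ]δ * E (suc (toℕ t)))
  sum-multiples n i E = sym (trans
    (sum-sparse (λ t → [ suc i ∣? t ]δ * E t) (λ s → suc s ℕ.* suc i)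
      (λ _ → ℕ.s≤s ℕ.z≤n)
      (λ {s} {s′} eq → ℕ.suc-injective (ℕ.*-cancelʳ-≡ (suc s) (suc s′) (suc i) eq))
      (λ s<n/i → ℕ.≤-trans (ℕ.*-monoˡ-≤ (suc i) s<n/i) (ℕ.m/n*n≤m n (suc i)))
      supp)
    (sum-cong-≋ {n ℕ./ suc i} λ s → trans
      (*-congʳ (δ-yes (suc i ∣? _) (n∣m*n (suc (toℕ s)))))
      (*-identityˡ (E (suc (toℕ s) ℕ.* suc i)))))
    where
    supp : ∀ t → t ℕ.< n →
      [ suc i ∣? suc t ]δ * E (suc t) ≈ 0# ⊎
      ∃[ s ] s ℕ.< n ℕ./ suc i × suc s ℕ.* suc i ≡ suc t
    supp t t<n with suc i ∣? suc t
    ... | no i∤t = inj₁ (δ-no-* (suc i ∣? suc t) _ i∤t)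
    ... | yes (divides (suc s) eq) = inj₂ (s , s<n/i , ≡.sym eq)
      where
      s<n/i : s ℕ.< n ℕ./ suc i
      s<n/i = ≡.subst (ℕ._≤ n ℕ./ suc i)
        (≡.trans (cong (ℕ._/ suc i) eq) (ℕ.m*n/n≡m (suc s) (suc i)))
        (ℕ./-monoˡ-≤ (suc i) t<n)

  -- The range of d in g f (suc m) may be enlarged, as d ∣ m + 1 forces
  -- d ≤ m + 1.
  g-extend : ∀ f {m n} → m ℕ.< n →
    g f (suc m) ≈ ∑[ i < n ] ([ suc (toℕ i) ∣? suc m ]δ * f (suc (toℕ i)))
  g-extend f {m} {n} m<n = sym (trans
    (sum-reindex (F ∘ toℕ) p (λ {i} {j} → Fin.inject≤-injective m<n m<n i j) supp)
    (sum-cong-≋ λ i → reflexive (cong F (Fin.toℕ-inject≤ i m<n))))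
    where
    F : ℕ → Carrier
    F i = [ suc i ∣? suc m ]δ * f (suc i)

    p : Fin (suc m) → Fin n
    p i = inject≤ i m<n

    supp : ∀ i → F (toℕ i) ≈ 0# ⊎ ∃[ j ] p j ≡ i
    supp i with toℕ i ℕ.≤? m
    ... | yes i≤m = inj₂ (fromℕ< (ℕ.s≤s i≤m) , Fin.toℕ-injective
      (≡.trans (Fin.toℕ-inject≤ _ m<n) (Fin.toℕ-fromℕ< (ℕ.s≤s i≤m))))
    ... | no  i≰m = inj₁ (δ-no-* (suc (toℕ i) ∣? suc m) _ λ i∣m → i≰m (ℕ.s≤s⁻¹ (∣⇒≤ i∣m)))

  -- Grouping the pairs (s, i) with si ≤ m by their product t.  The bound n on i
  -- may exceed m: for i > m the inner sum is empty.
  sum-divisors : ∀ f {m n} → m ℕ.≤ n → (E : ℕ → Carrier) →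
    ∑[ i < n ] (∑[ s < m ℕ./ suc (toℕ i) ] E (suc (toℕ s) ℕ.* suc (toℕ i)) * f (suc (toℕ i))) ≈
    ∑[ t < m ] (E (suc (toℕ t)) * g f (suc (toℕ t)))
  sum-divisors f {m} {n} m≤n E = begin
    ∑[ i < n ] (∑[ s < m ℕ./ suc (toℕ i) ] E (suc (toℕ s) ℕ.* suc (toℕ i)) * f (suc (toℕ i)))
      ≈⟨ sum-cong-≋ {n} (λ i → trans (*-congʳ (sum-multiples m (toℕ i) E))
           (*-distribʳ-sum (f (suc (toℕ i))) (λ t → D i t * E (suc (toℕ t))))) ⟩
    ∑[ i < n ] ∑[ t < m ] (D i t * E (suc (toℕ t)) * f (suc (toℕ i)))
      ≈⟨ ∑-comm (λ i t → D i t * E (suc (toℕ t)) * f (suc (toℕ i))) ⟩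
    ∑[ t < m ] ∑[ i < n ] (D i t * E (suc (toℕ t)) * f (suc (toℕ i)))
      ≈⟨ sum-cong-≋ {m} (λ t → trans
           (sum-cong-≋ {n} λ i → trans (*-congʳ (*-comm (D i t) (E (suc (toℕ t))))) (*-assoc _ _ _))
           (sym (*-distribˡ-sum (E (suc (toℕ t))) (λ i → D i t * f (suc (toℕ i)))))) ⟩
    ∑[ t < m ] (E (suc (toℕ t)) * ∑[ i < n ] (D i t * f (suc (toℕ i))))
      ≈⟨ sum-cong-≋ {m} (λ t → *-congˡ {E (suc (toℕ t))}
           (sym (g-extend f (ℕ.<-≤-trans (Fin.toℕ<n t) m≤n)))) ⟩
    ∑[ t < m ] (E (suc (toℕ t)) * g f (suc (toℕ t))) ∎
    where
    D : Fin n → Fin m → Carrier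
    D i t = [ suc (toℕ i) ∣? suc (toℕ t) ]δ

  -- Signs at the pentagonal numbers

  -- The b-summand of a: (-1)^k if N = P(k, b) with 6k + b ≥ 0, and 0 otherwise.
  pentagonalSign : ℤ → ℕ → Carrier
  pentagonalSign b N = (- 1#) ^ root N b * [ [√ disc N - b ]/6∈ℤ? ]δ

  pentagonalSign-pentagonal : ∀ {b} → ±1 b → ∀ j →
    pentagonalSign b (pentagonal (suc j) b) ≈ (- 1#) ^ suc j
  pentagonalSign-pentagonal {b} b∈ j = trans
    (*-cong (reflexive (cong ((- 1#) ^_) (root-pentagonal b∈ j)))
            (δ-yes [√ disc (pentagonal (suc j) b) - b ]/6∈ℤ? (pentagonal-∈ℤ b∈ j)))
    (*-identityʳ _)

  pentagonalSign-support : ∀ {b} → ±1 b → ∀ N →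
    pentagonalSign b N ≈ 0# ⊎ ∃[ k ] N ≡ pentagonal k b
  pentagonalSign-support {b} b∈ N with [√ disc N - b ]/6∈ℤ?
  ... | yes p = inj₂ (root N b , ∈ℤ⇒pentagonal b∈ N p)
  ... | no ¬p = inj₁ (trans (*-congˡ (δ-no [√ disc N - b ]/6∈ℤ? ¬p)) (zeroʳ _))

  -- If P(j + 1, b) were 0, then root 0 b, which evaluates to 0, would be j + 1.
  pentagonal>0 : ∀ {b} → ±1 b → ∀ j → 0 ℕ.< pentagonal (suc j) b
  pentagonal>0 {b} b∈ j = ℕ.n≢0⇒n>0 λ eq →
    contra b∈ (≡.trans (≡.sym (cong (λ N → root N b) eq)) (root-pentagonal b∈ j))
    where
    contra : ∀ {b} → ±1 b → root 0 b ≢ suc j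
    contra (inj₁ ≡.refl) ()
    contra (inj₂ ≡.refl) ()

  pentagonal-injective : ∀ {b} → ±1 b → ∀ {i j} →
    pentagonal (suc i) b ≡ pentagonal (suc j) b → i ≡ j
  pentagonal-injective {b} b∈ {i} {j} eq = ℕ.suc-injective (≡.trans
    (≡.sym (root-pentagonal b∈ i)) (≡.trans (cong (λ N → root N b) eq) (root-pentagonal b∈ j)))

  -- The term N = 0 is kept apart, since its coefficient depends on b: it is 1
  -- for b = 1 and 0 for b = -1.
  pentagonalSign-convolution : ∀ {b} → ±1 b → ∀ m (H : ℕ → Carrier) →
    ∑[ N < suc m ] (pentagonalSign b (toℕ N) * H (toℕ N)) ≈
    pentagonalSign b 0 * H 0 +
    ∑[ j < root m b ] ((- 1#) ^ suc (toℕ j) * H (pentagonal (suc (toℕ j)) b))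
  pentagonalSign-convolution {b} b∈ m H = +-congˡ (trans
    (sum-sparse {m} {root m b} (λ N → pentagonalSign b N * H N) (λ j → pentagonal (suc j) b)
      (pentagonal>0 b∈) (pentagonal-injective b∈) (λ {j} → pentagonal≤ b∈ j)
      λ N N<m → supp (suc N) (ℕ.s≤s ℕ.z≤n) N<m)
    (sum-cong-≋ {root m b} λ j → *-congʳ (pentagonalSign-pentagonal b∈ (toℕ j))))
    where
    supp : ∀ N → 0 ℕ.< N → N ℕ.≤ m →
      pentagonalSign b N * H N ≈ 0# ⊎ ∃[ j ] j ℕ.< root m b × pentagonal (suc j) b ≡ N
    supp N N>0 N≤m with pentagonalSign-support b∈ N
    ... | inj₁ sign≈0 = inj₁ (trans (*-congʳ sign≈0) (zeroˡ _))
    ... | inj₂ (zero  , N≡) = ⊥-elim (ℕ.<-irrefl (≡.sym N≡) N>0)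
    ... | inj₂ (suc j , N≡) = inj₂ (j , ≤root b∈ (suc j) (≡.subst (ℕ._≤ m) N≡ N≤m) , ≡.sym N≡)

  pentagonalSign₊0≈1 : pentagonalSign 1ℤ 0 ≈ 1#
  pentagonalSign₊0≈1 = *-identityˡ 1#

  pentagonalSign₋0≈0 : pentagonalSign -1ℤ 0 ≈ 0#
  pentagonalSign₋0≈0 = zeroʳ _

  -- The identity A f = B

  sum-neg : ∀ {n} (F : Fin n → Carrier) → ∑[ i < n ] (- F i) ≈ - sum F
  sum-neg {zero}  F = sym -0#≈0#
  sum-neg {suc n} F = trans (+-congˡ (sum-neg (F ∘ suc))) (-‿+-comm (F zero) (sum (F ∘ suc)))

  -- ∑_{k ≥ 1, P(k, b) ≤ m} (-1)^k h(m + 1 - P(k, b)), the negative of the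
  -- b-summand subtracted in B h m.
  pentagonalSum : (ℕ → Carrier) → ℕ → ℤ → Carrier
  pentagonalSum h m b =
    ∑[ j < root m b ] ((- 1#) ^ suc (toℕ j) * h (m ℕ.+ 1 ℕ.∸ pentagonal (suc (toℕ j)) b))

  -- The b-part of the entry of A f in row m + 1.  The second step is the
  -- substitution N = m - t.
  columns-sum : ∀ {b} → ±1 b → ∀ f m {n} → m ℕ.< n →
    ∑[ k < n ] (∑[ s < suc m ℕ./ suc (toℕ k) ]
      pentagonalSign b (suc m ℕ.∸ suc (toℕ s) ℕ.* suc (toℕ k)) * f (suc (toℕ k)))
    ≈ pentagonalSign b 0 * g f (m ℕ.+ 1) + pentagonalSum (g f) m b
  columns-sum {b} b∈ f m {n} m<n = begin
    ∑[ k < n ] (∑[ s < suc m ℕ./ suc (toℕ k) ]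
      pentagonalSign b (suc m ℕ.∸ suc (toℕ s) ℕ.* suc (toℕ k)) * f (suc (toℕ k)))
      ≈⟨ sum-divisors f m<n (λ t → pentagonalSign b (suc m ℕ.∸ t)) ⟩
    ∑[ t < suc m ] (pentagonalSign b (m ℕ.∸ toℕ t) * g f (suc (toℕ t)))
      ≈⟨ sum-reverse m (λ t → pentagonalSign b (m ℕ.∸ t) * g f (suc t)) ⟩
    ∑[ N < suc m ] (pentagonalSign b (m ℕ.∸ (m ℕ.∸ toℕ N)) * g f (suc (m ℕ.∸ toℕ N)))
      ≈⟨ sum-cong-≋ {suc m}
           {λ N → pentagonalSign b (m ℕ.∸ (m ℕ.∸ toℕ N)) * g f (suc (m ℕ.∸ toℕ N))}
           {λ N → pentagonalSign b (toℕ N) * g f (m ℕ.+ 1 ℕ.∸ toℕ N)} (λ N → *-cong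
           (reflexive (cong (pentagonalSign b) (ℕ.m∸[m∸n]≡n (Fin.toℕ≤pred[n] N))))
           (reflexive (cong (g f) (suc-∸ (Fin.toℕ≤pred[n] N))))) ⟩
    ∑[ N < suc m ] (pentagonalSign b (toℕ N) * g f (m ℕ.+ 1 ℕ.∸ toℕ N))
      ≈⟨ pentagonalSign-convolution b∈ m (λ N → g f (m ℕ.+ 1 ℕ.∸ N)) ⟩
    pentagonalSign b 0 * g f (m ℕ.+ 1) + pentagonalSum (g f) m b ∎
    where
    suc-∸ : ∀ {N} → N ℕ.≤ m → suc (m ℕ.∸ N) ≡ m ℕ.+ 1 ℕ.∸ N
    suc-∸ {N} N≤m = ≡.sym (≡.trans (ℕ.+-∸-comm 1 N≤m) (ℕ.+-comm (m ℕ.∸ N) 1))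

  B≈ : ∀ h m → B h m ≈ h (m ℕ.+ 1) + (pentagonalSum h m 1ℤ + pentagonalSum h m -1ℤ)
  B≈ h m = +-congˡ (trans
    (-‿cong (trans (+-cong (terms≈ 1ℤ) (terms≈ -1ℤ)) (-‿+-comm _ _)))
    (-‿involutive _))
    where
    negate : ∀ k x → (- 1#) ^ (k ℕ.+ 1) * x ≈ - ((- 1#) ^ k * x)
    negate k x = trans (*-congʳ (trans (reflexive (cong ((- 1#) ^_) (ℕ.+-comm k 1))) (-1*x≈-x _)))
                       (sym (-‿distribˡ-* _ x))

    terms≈ : ∀ b →
      ∑[ j < root m b ] ((- 1#) ^ (suc (toℕ j) ℕ.+ 1) * h (m ℕ.+ 1 ℕ.∸ pentagonal (suc (toℕ j)) b))
      ≈ - pentagonalSum h m b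
    terms≈ b = trans (sum-cong-≋ {root m b} λ j → negate (suc (toℕ j)) _)
      (sum-neg {root m b} (λ j → (- 1#) ^ suc (toℕ j) * h (m ℕ.+ 1 ℕ.∸ pentagonal (suc (toℕ j)) b)))

  A*f≈B : ∀ f n → A n *ⱽ (λ i → f (suc (toℕ i))) ≈ⱽ (λ i → B (g f) (toℕ i))
  A*f≈B f n i = begin
    ∑[ k < n ] ((S 1ℤ k + S -1ℤ k) * F k)
      ≈⟨ sum-cong-≋ {n} (λ k → distribʳ (F k) (S 1ℤ k) (S -1ℤ k)) ⟩
    ∑[ k < n ] (S 1ℤ k * F k + S -1ℤ k * F k)
      ≈⟨ ∑-distrib-+ (λ k → S 1ℤ k * F k) (λ k → S -1ℤ k * F k) ⟩
    ∑[ k < n ] (S 1ℤ k * F k) + ∑[ k < n ] (S -1ℤ k * F k)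
      ≈⟨ +-cong (columns-sum (inj₁ ≡.refl) f m m<n) (columns-sum (inj₂ ≡.refl) f m m<n) ⟩
    (pentagonalSign 1ℤ 0 * h₀ + U₊) + (pentagonalSign -1ℤ 0 * h₀ + U₋)
      ≈⟨ +-cong (+-congʳ (trans (*-congʳ pentagonalSign₊0≈1) (*-identityˡ h₀)))
                (trans (+-congʳ (trans (*-congʳ pentagonalSign₋0≈0) (zeroˡ h₀))) (+-identityˡ U₋)) ⟩
    (h₀ + U₊) + U₋
      ≈⟨ +-assoc h₀ U₊ U₋ ⟩
    h₀ + (U₊ + U₋)
      ≈⟨ B≈ (g f) m ⟨
    B (g f) m ∎
    where
    m = toℕ i
    m<n = Fin.toℕ<n i
    F : Fin n → Carrier
    F k = f (suc (toℕ k))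
    S : ℤ → Fin n → Carrier
    S b k = ∑[ s < suc m ℕ./ suc (toℕ k) ] pentagonalSign b (suc m ℕ.∸ suc (toℕ s) ℕ.* suc (toℕ k))
    h₀ = g f (m ℕ.+ 1)
    U₊ = pentagonalSum (g f) m 1ℤ
    U₋ = pentagonalSum (g f) m -1ℤ

  -- Unit lower triangular matrices

  -- Lower triangular with ones on the diagonal.
  UnitLower : ∀ {n} → Matrix n → Set _
  UnitLower M = (∀ i → M i i ≈ 1#) × (∀ i j → i Fin.< j → M i j ≈ 0#)

  A-unitLower : ∀ n → UnitLower (A n)
  A-unitLower n = (λ i → a-diag (toℕ i)) , (λ i j i<j → a-above (toℕ i) (toℕ j) i<j)
    where
    S : ℤ → ℕ → ℕ → ℕ → Carrier
    S b m i q = ∑[ s < q ] pentagonalSign b (suc m ℕ.∸ suc (toℕ s) ℕ.* suc i)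

    a-above : ∀ m i → m ℕ.< i → a (suc m) (suc i) ≈ 0#
    a-above m i m<i = trans
      (reflexive (cong (λ q → S 1ℤ m i q + S -1ℤ m i q) (ℕ.m<n⇒m/n≡0 (ℕ.s<s m<i))))
      (+-identityʳ 0#)

    a-diag : ∀ m → a (suc m) (suc m) ≈ 1#
    a-diag m = begin
      a (suc m) (suc m)
        ≡⟨ cong (λ q → S 1ℤ m m q + S -1ℤ m m q) (ℕ.n/n≡1 (suc m)) ⟩
      S 1ℤ m m 1 + S -1ℤ m m 1
        ≈⟨ +-cong (+-identityʳ _) (+-identityʳ _) ⟩
      pentagonalSign 1ℤ (suc m ℕ.∸ 1 ℕ.* suc m) + pentagonalSign -1ℤ (suc m ℕ.∸ 1 ℕ.* suc m)
        ≡⟨ cong (λ N → pentagonalSign 1ℤ N + pentagonalSign -1ℤ N)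
             (≡.trans (cong (suc m ℕ.∸_) (ℕ.*-identityˡ (suc m))) (ℕ.n∸n≡0 (suc m))) ⟩
      pentagonalSign 1ℤ 0 + pentagonalSign -1ℤ 0
        ≈⟨ +-cong pentagonalSign₊0≈1 pentagonalSign₋0≈0 ⟩
      1# + 0#
        ≈⟨ +-identityʳ 1# ⟩
      1# ∎

  -- A column of M *ᴹ N is, by definition, M *ⱽ the corresponding column of N;
  -- so this also gives associativity of *ᴹ, column by column.
  *ⱽ-assoc : ∀ {n} (M N : Matrix n) v → (M *ᴹ N) *ⱽ v ≈ⱽ M *ⱽ (N *ⱽ v)
  *ⱽ-assoc {n} M N v i = begin
    ∑[ k < n ] (∑[ l < n ] (M i l * N l k) * v k)
      ≈⟨ sum-cong-≋ {n} (λ k → trans (*-distribʳ-sum (v k) (λ l → M i l * N l k))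
           (sum-cong-≋ {n} λ l → *-assoc (M i l) (N l k) (v k))) ⟩
    ∑[ k < n ] ∑[ l < n ] (M i l * (N l k * v k))
      ≈⟨ ∑-comm (λ k l → M i l * (N l k * v k)) ⟩
    ∑[ l < n ] ∑[ k < n ] (M i l * (N l k * v k))
      ≈⟨ sum-cong-≋ {n} (λ l → sym (*-distribˡ-sum (M i l) (λ k → N l k * v k))) ⟩
    ∑[ l < n ] (M i l * ∑[ k < n ] (N l k * v k)) ∎

  *ⱽ-cong : ∀ {n} {M N : Matrix n} {u v} → M ≈ᴹ N → u ≈ⱽ v → M *ⱽ u ≈ⱽ N *ⱽ v
  *ⱽ-cong {n} M≈N u≈v i = sum-cong-≋ {n} λ k → *-cong (M≈N i k) (u≈v k)

  *ⱽ-identityˡ : ∀ {n} (v : Vector n) → 1ᴹ *ⱽ v ≈ⱽ v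
  *ⱽ-identityˡ v i = trans
    (sum-single (λ k → 1ᴹ i k * v k) i λ k k≢i → δ-no-* (i Fin.≟ k) (v k) (k≢i ∘ ≡.sym))
    (trans (*-congʳ (δ-yes (i Fin.≟ i) ≡.refl)) (*-identityˡ (v i)))

  *ᴹ-identityʳ : ∀ {n} (M : Matrix n) → M *ᴹ 1ᴹ ≈ᴹ M
  *ᴹ-identityʳ M i j = trans
    (sum-single (λ k → M i k * 1ᴹ k j) j λ k k≢j →
      trans (*-congˡ (δ-no (k Fin.≟ j) k≢j)) (zeroʳ (M i k)))
    (trans (*-congˡ (δ-yes (j Fin.≟ j) ≡.refl)) (*-identityʳ (M i j)))

  -- By induction on n, in block form: if L′ M′ = 1, then
  --
  --   (    1      0  ) ( 1  0  )
  --   ( -L′ c    L′  ) ( c  M′ )  =  1.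
  unitLower⇒leftInverse : ∀ {n} (M : Matrix n) → UnitLower M →
    ∃[ L ] UnitLower L × L *ᴹ M ≈ᴹ 1ᴹ
  unitLower⇒leftInverse {zero}  M _ = (λ ()) , ((λ ()) , λ ()) , λ ()
  unitLower⇒leftInverse {suc n} M (diag , above) with
    unitLower⇒leftInverse (λ i j → M (suc i) (suc j))
      ((λ i → diag (suc i)) , (λ i j i<j → above (suc i) (suc j) (ℕ.s<s i<j)))
  ... | L′ , (diag′ , above′) , L′M′≈1 = L , (L-diag , L-above) , LM≈1
    where
    -- The block L′ c, where c is the first column of M below the diagonal.
    L′c : Fin n → Carrier
    L′c i = ∑[ k < n ] (L′ i k * M (suc k) zero)

    L : Matrix (suc n)
    L zero    zero    = 1#
    L zero    (suc j) = 0#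
    L (suc i) zero    = - L′c i
    L (suc i) (suc j) = L′ i j

    L-diag : ∀ i → L i i ≈ 1#
    L-diag zero    = refl
    L-diag (suc i) = diag′ i

    L-above : ∀ i j → i Fin.< j → L i j ≈ 0#
    L-above zero    (suc j) _         = refl
    L-above (suc i) (suc j) (ℕ.s≤s p) = above′ i j p

    row₀ : ∀ j → (L *ᴹ M) zero j ≈ M zero j
    row₀ j = trans
      (+-cong (*-identityˡ _) (sum-zero (λ k → 0# * M (suc k) j) λ k → zeroˡ _))
      (+-identityʳ _)

    LM≈1 : L *ᴹ M ≈ᴹ 1ᴹ
    LM≈1 zero    zero    = trans (row₀ zero) (diag zero)
    LM≈1 zero    (suc j) = trans (row₀ (suc j)) (above zero (suc j) (ℕ.s≤s ℕ.z≤n))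
    LM≈1 (suc i) zero    =
      trans (+-congʳ (trans (*-congˡ (diag zero)) (*-identityʳ _))) (-‿inverseˡ (L′c i))
    LM≈1 (suc i) (suc j) =
      trans (+-cong (trans (*-congˡ (above zero (suc j) (ℕ.s≤s ℕ.z≤n))) (zeroʳ _)) (L′M′≈1 i j))
            (+-identityˡ _)

  -- The left inverse L of M is itself unit lower triangular, so it has a left
  -- inverse K; then K = K(LM) = (KL)M = M, and L is a right inverse of M too.
  unitLower⇒invertible : ∀ {n} (M : Matrix n) → UnitLower M → Invertible M
  unitLower⇒invertible M M-unit with unitLower⇒leftInverse M M-unit
  ... | L , L-unit , LM≈1 with unitLower⇒leftInverse L L-unit
  ... | K , _ , KL≈1 = L , LM≈1 , ML≈1
    where
    K≈M : K ≈ᴹ M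
    K≈M i j = begin
      K i j               ≈⟨ *ᴹ-identityʳ K i j ⟨
      (K *ᴹ 1ᴹ) i j       ≈⟨ *ⱽ-cong {M = K} (λ _ _ → refl) (λ k → LM≈1 k j) i ⟨
      (K *ᴹ (L *ᴹ M)) i j ≈⟨ *ⱽ-assoc K L (λ k → M k j) i ⟨
      ((K *ᴹ L) *ᴹ M) i j ≈⟨ *ⱽ-cong {u = λ k → M k j} KL≈1 (λ _ → refl) i ⟩
      (1ᴹ *ᴹ M) i j       ≈⟨ *ⱽ-identityˡ (λ k → M k j) i ⟩
      M i j               ∎

    ML≈1 : M *ᴹ L ≈ᴹ 1ᴹ
    ML≈1 i j = trans (sym (*ⱽ-cong {u = λ k → L k j} K≈M (λ _ → refl) i)) (KL≈1 i j)

theorem1p3 : ∀ {c ℓ} (R : CommutativeRing c ℓ) → let open LambertFactorization R in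
    (f : Arithmetic) (n : ℕ) .{{_ : NonZero n}} →
    Σ (Invertible (A n)) λ (A⁻¹ , _) →
    (λ i → f (suc (toℕ i))) ≈ⱽ A⁻¹ *ⱽ (λ i → B (g f) (toℕ i))
theorem1p3 R f n = A-inv , λ i → begin
  f⃗ i                   ≈⟨ *ⱽ-identityˡ R f⃗ i ⟨
  (1ᴹ *ⱽ f⃗) i           ≈⟨ *ⱽ-cong R {u = f⃗} A⁻¹A≈1 (λ _ → refl) i ⟨
  ((A⁻¹ *ᴹ A n) *ⱽ f⃗) i ≈⟨ *ⱽ-assoc R A⁻¹ (A n) f⃗ i ⟩
  (A⁻¹ *ⱽ (A n *ⱽ f⃗)) i ≈⟨ *ⱽ-cong R {M = A⁻¹} (λ _ _ → refl) (A*f≈B R f n) i ⟩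
  (A⁻¹ *ⱽ (λ k → B (g f) (toℕ k))) i ∎
  where
  open LambertFactorization R
  open CommutativeRing R using (refl; setoid)
  open Relation.Binary.Reasoning.Setoid setoid

  f⃗ : Vector n
  f⃗ i = f (suc (toℕ i))

  A-inv : Invertible (A n)
  A-inv = unitLower⇒invertible R (A n) (A-unitLower R n)

  A⁻¹ : Matrix n
  A⁻¹ = proj₁ A-inv

  A⁻¹A≈1 : A⁻¹ *ᴹ A n ≈ᴹ 1ᴹ
  A⁻¹A≈1 = proj₁ (proj₂ A-inv)
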